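{- There exists an abelian $16$-power free morphism $h:\Sigma^*\to\Sigma^*$ over the binary alphabet $\Sigma=\{a,b\}$ with an infinite fixed point $\Omega_3\in\Sigma^{\mathbb{N}}$ such that: (i) $aaa$ is not a factor of $\Omega_3$; (ii) $bb$ is not a factor of $\Omega_3$; (iii) $\Omega_3$ is abelian $16$-power free.
   Context: $\Sigma^*$ is the free monoid of finite words over $\Sigma$, with empty word $\epsilon$. A morphism is a monoid homomorphism $h:\Sigma^*\to\Sigma^*$; it extends to infinite words letter by letter, and an infinite word $\Omega$ is a fixed point of $h$ if $h(\Omega)=\Omega$. A factor of a word is a contiguous finite subword. The Parikh vector $\psi(u)$ of a finite word $u$ records the number of occurrences of each letter in $u$. A word $u$ (finite or infinite) is abelian $k$-power free if whenever $u=xv_1\cdots v_ky$ with $\psi(v_1)=\cdots=\psi(v_k)$, one has $v_1=\cdots=v_k=\epsilon$. A morphism $h$ is abelian $n$-power free if $h(u)$ is abelian $n$-power free for every abelian $n$-power free word $u$. -}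

module Defs where

open import Algebra.Morphism.Structures using (module MonoidMorphisms)
open import Data.Fin.Base using (Fin)
open import Data.List.Base
  using (List; []; _∷_; _++_; [_]; length; filter; concat; tabulate; applyUpTo; ++-[]-rawMonoid)
open import Data.Nat.Base using (ℕ; zero; suc; _≤_)
open import Data.Product.Base using (_×_; ∃-syntax)
open import Relation.Binary.Definitions using (DecidableEquality)
open import Relation.Binary.PropositionalEquality using (_≡_; _≗_; refl)
open import Relation.Nullary.Decidable.Core using (yes; no)

data Letter : Set where
  a b : Letter

_≟_ : DecidableEquality Letter
a ≟ a = yes refl
a ≟ b = no λ ()
b ≟ a = no λ ()
b ≟ b = yes refl

Word : Set
Word = List Letter

-- Without function extensionality, infinite words are compared by _≗_.
InfiniteWord : Set
InfiniteWord = ℕ → Letter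

infixr 5 _++ω_

_++ω_ : Word → InfiniteWord → InfiniteWord
([]      ++ω y) n       = y n
((c ∷ x) ++ω y) zero    = c
((c ∷ x) ++ω y) (suc n) = (x ++ω y) n

Prefixω : Word → InfiniteWord → Set
Prefixω p Ω = ∃[ y ] Ω ≗ p ++ω y

Factorω : Word → InfiniteWord → Set
Factorω u Ω = ∃[ x ] ∃[ y ] Ω ≗ x ++ω u ++ω y

ψ : Word → Letter → ℕ
ψ u c = length (filter (_≟ c) u)

AbelianPowerFree : ℕ → Word → Set
AbelianPowerFree k u =
  ∀ (x : Word) (v : Fin k → Word) (y : Word) →
  u ≡ x ++ concat (tabulate v) ++ y →
  (∀ i j → ψ (v i) ≗ ψ (v j)) →
  ∀ i → v i ≡ []

AbelianPowerFreeω : ℕ → InfiniteWord → Set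
AbelianPowerFreeω k Ω =
  ∀ (x : Word) (v : Fin k → Word) (y : InfiniteWord) →
  Ω ≗ x ++ω concat (tabulate v) ++ω y →
  (∀ i j → ψ (v i) ≗ ψ (v j)) →
  ∀ i → v i ≡ []

open MonoidMorphisms (++-[]-rawMonoid Letter) (++-[]-rawMonoid Letter) public
  using () renaming (IsMonoidHomomorphism to IsMorphism)

AbelianPowerFreeMorphism : ℕ → (Word → Word) → Set
AbelianPowerFreeMorphism n h = ∀ u → AbelianPowerFree n u → AbelianPowerFree n (h u)

-- h(Ω) = Ω′, where h(Ω) is the infinite concatenation h(Ω 0) h(Ω 1) h(Ω 2) ⋯.
-- As h may erase letters, that concatenation can be finite; the second
-- component says that it is not.
Imageω : (Word → Word) → InfiniteWord → InfiniteWord → Set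
Imageω h Ω Ω′ =
  (∀ n → Prefixω (image n) Ω′) × (∀ m → ∃[ n ] m ≤ length (image n))
  where
  image : ℕ → Word
  image n = concat (applyUpTo (λ i → h [ Ω i ]) n)

FixedPoint : (Word → Word) → InfiniteWord → Set
FixedPoint h Ω = Imageω h Ω Ω

{-# OPTIONS --safe #-}

-- Dekking's method with h(a) = abaabaababa and h(b) = babab.  Weigh a by 1 and
-- b by 8 modulo 13.  Both images have weight 0, and no prefix of a word h(u)
-- has weight 2.  The weights of the 17 cuts of a sixteenth abelian power in
-- h(u) form an arithmetic progression, which modulo the prime 13 would hit 2 if
-- it were not constant.  Hence all cuts have the same weight; the weight
-- determines, up to abelian equivalence, the position of a cut relative to the
-- boundary of some image of a letter, so all the cuts can be moved to boundaries by
-- one common translation.  Thus the power is abelian equivalent, block by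
-- block, to the image of consecutive factors of u, and these form an abelian
-- power because the incidence matrix of h is invertible (its determinant is 13).
module Submission where

open import Defs
open import Data.Empty using (⊥)
open import Data.Fin.Base using (Fin; zero; suc)
open import Data.List.Base
  using ([]; _∷_; _++_; [_]; length; filter; concat; concatMap; tabulate; applyUpTo; inits)
open import Data.List.Properties
  using (∷-injective; ++-assoc; ++-cancelˡ; ++-identityʳ; filter-++; length-++; length-applyUpTo; concatMap-++)
open import Data.List.Relation.Unary.All using (All; []; _∷_; all?)
open import Data.List.Relation.Unary.All.Properties using (map⁻)
open import Data.Nat.Base
  using (ℕ; zero; suc; _+_; _*_; _≤_; _<_; z≤n; s≤s; s≤s⁻¹)
open import Data.Nat.DivMod using (_%_; m%n<n; %-distribˡ-+; %-distribˡ-*; m%n%n≡m%n)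
open import Data.Nat.Properties as ℕ
  using (+-assoc; +-comm; +-identityʳ; +-cancelˡ-≡; +-cancelʳ-≡; *-cancelˡ-≡;
         m+n≡0⇒m≡0; m+n≡0⇒n≡0; ≤-refl; ≤-trans; ≤-reflexive; m≤m+n; m≤n+m; n≤0⇒n≡0; +-monoʳ-≤)
open import Data.Nat.Solver using (module +-*-Solver)
open import Data.Product.Base using (_×_; _,_; ∃-syntax)
open import Data.Sum.Base using (_⊎_; inj₁; inj₂)
open import Data.Unit.Base using (⊤; tt)
open import Function.Base using (_∘_)
open import Relation.Binary.Definitions using (Decidable)
open import Relation.Binary.PropositionalEquality
  using (_≡_; _≢_; _≗_; refl; sym; trans; cong; cong₂; subst; module ≡-Reasoning)
open import Relation.Nullary.Decidable using (Dec; yes; no; _×-dec_; _⊎-dec_; _→-dec_; ¬?; map′; from-yes)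
open import Relation.Nullary.Negation.Core using (¬_; contradiction)

open +-*-Solver using (solve; _:+_; _:*_; con; _:=_)

-- Words, their factorisations and abelian equivalence.

++-split : ∀ (p {q} x {y} : Word) → p ++ q ≡ x ++ y →
           (∃[ r ] p ≡ x ++ r) ⊎ (∃[ r ] x ≡ p ++ r × q ≡ r ++ y)
++-split []      x       eq = inj₂ (x , refl , eq)
++-split (c ∷ p) []      eq = inj₁ (c ∷ p , refl)
++-split (c ∷ p) (d ∷ x) eq with ∷-injective eq
... | refl , eq′ with ++-split p x eq′
... | inj₁ (r , refl)        = inj₁ (r , refl)
... | inj₂ (r , refl , eq″)  = inj₂ (r , refl , eq″)

All-inits : ∀ {P : Word → Set} x {r} → All P (inits (x ++ r)) → P x
All-inits []      (p ∷ _)  = p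
All-inits (c ∷ x) (_ ∷ ps) = All-inits x (map⁻ ps)

infix 4 _~_ _~?_

_~_ : Word → Word → Set
u ~ v = ψ u ≗ ψ v

_~?_ : Decidable _~_
u ~? v = map′ (λ { (p , q) a → p ; (p , q) b → q }) (λ e → e a , e b)
              ((ψ u a ℕ.≟ ψ v a) ×-dec (ψ u b ℕ.≟ ψ v b))

ψ-++ : ∀ u v c → ψ (u ++ v) c ≡ ψ u c + ψ v c
ψ-++ u v c = trans (cong length (filter-++ (_≟ c) u v)) (length-++ (filter (_≟ c) u))

ψ≗0⇒[] : ∀ u → (∀ c → ψ u c ≡ 0) → u ≡ []
ψ≗0⇒[] []      e = refl
ψ≗0⇒[] (a ∷ u) e with () ← e a
ψ≗0⇒[] (b ∷ u) e with () ← e b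

-- The morphism and its incidence matrix.

image : Letter → Word
image a = a ∷ b ∷ a ∷ a ∷ b ∷ a ∷ a ∷ b ∷ a ∷ b ∷ a ∷ []
image b = b ∷ a ∷ b ∷ a ∷ b ∷ []

h : Word → Word
h = concatMap image

h-isMorphism : IsMorphism h
h-isMorphism = record
  { isMagmaHomomorphism = record
    { isRelHomomorphism = record { cong = cong h }
    ; homo = concatMap-++ image
    }
  ; ε-homo = refl
  }

ψ-h-++ : ∀ u v c → ψ (h (u ++ v)) c ≡ ψ (h u) c + ψ (h v) c
ψ-h-++ u v c = trans (cong (λ w → ψ w c) (concatMap-++ image u v)) (ψ-++ (h u) (h v) c)

ψ-h-a : ∀ u → ψ (h u) a ≡ 7 * ψ u a + 2 * ψ u b
ψ-h-a []      = refl
ψ-h-a (a ∷ u) = trans (cong (7 +_) (ψ-h-a u))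
  (solve 2 (λ x y → con 7 :+ (con 7 :* x :+ con 2 :* y) := con 7 :* (con 1 :+ x) :+ con 2 :* y)
    refl (ψ u a) (ψ u b))
ψ-h-a (b ∷ u) = trans (cong (2 +_) (ψ-h-a u))
  (solve 2 (λ x y → con 2 :+ (con 7 :* x :+ con 2 :* y) := con 7 :* x :+ con 2 :* (con 1 :+ y))
    refl (ψ u a) (ψ u b))

ψ-h-b : ∀ u → ψ (h u) b ≡ 4 * ψ u a + 3 * ψ u b
ψ-h-b []      = refl
ψ-h-b (a ∷ u) = trans (cong (4 +_) (ψ-h-b u))
  (solve 2 (λ x y → con 4 :+ (con 4 :* x :+ con 3 :* y) := con 4 :* (con 1 :+ x) :+ con 3 :* y)
    refl (ψ u a) (ψ u b))
ψ-h-b (b ∷ u) = trans (cong (3 +_) (ψ-h-b u))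
  (solve 2 (λ x y → con 3 :+ (con 4 :* x :+ con 3 :* y) := con 4 :* x :+ con 3 :* (con 1 :+ y))
    refl (ψ u a) (ψ u b))

-- Cramer's rule, with the negative terms moved to the other side.
cramer-a : ∀ u → 13 * ψ u a + 2 * ψ (h u) b ≡ 3 * ψ (h u) a
cramer-a u rewrite ψ-h-a u | ψ-h-b u =
  solve 2 (λ x y → con 13 :* x :+ con 2 :* (con 4 :* x :+ con 3 :* y)
                   := con 3 :* (con 7 :* x :+ con 2 :* y))
    refl (ψ u a) (ψ u b)

cramer-b : ∀ u → 13 * ψ u b + 4 * ψ (h u) a ≡ 7 * ψ (h u) b
cramer-b u rewrite ψ-h-a u | ψ-h-b u =
  solve 2 (λ x y → con 13 :* y :+ con 4 :* (con 7 :* x :+ con 2 :* y)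
                   := con 7 :* (con 4 :* x :+ con 3 :* y))
    refl (ψ u a) (ψ u b)

-- Cramer's rule recovers `13 * ψ u c` from `ψ (h u)`, and the determinant 13 can be cancelled.
h-reflects-~ : ∀ u v → h u ~ h v → u ~ v
h-reflects-~ u v e a = *-cancelˡ-≡ _ _ 13 (+-cancelʳ-≡ (2 * ψ (h v) b) _ _ (begin
  13 * ψ u a + 2 * ψ (h v) b  ≡⟨ cong (λ n → 13 * ψ u a + 2 * n) (e b) ⟨
  13 * ψ u a + 2 * ψ (h u) b  ≡⟨ cramer-a u ⟩
  3 * ψ (h u) a               ≡⟨ cong (3 *_) (e a) ⟩
  3 * ψ (h v) a               ≡⟨ cramer-a v ⟨
  13 * ψ v a + 2 * ψ (h v) b  ∎))
  where open ≡-Reasoning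
h-reflects-~ u v e b = *-cancelˡ-≡ _ _ 13 (+-cancelʳ-≡ (4 * ψ (h v) a) _ _ (begin
  13 * ψ u b + 4 * ψ (h v) a  ≡⟨ cong (λ n → 13 * ψ u b + 4 * n) (e a) ⟨
  13 * ψ u b + 4 * ψ (h u) a  ≡⟨ cramer-b u ⟩
  7 * ψ (h u) b               ≡⟨ cong (7 *_) (e b) ⟩
  7 * ψ (h v) b               ≡⟨ cramer-b v ⟨
  13 * ψ v b + 4 * ψ (h v) a  ∎))
  where open ≡-Reasoning

-- Weights modulo 13 and anchored prefixes.

weight : Word → ℕ
weight u = ψ u a + 8 * ψ u b

weight-++ : ∀ u v → weight (u ++ v) ≡ weight u + weight v
weight-++ u v rewrite ψ-++ u v a | ψ-++ u v b =
  solve 4 (λ x y z w → (x :+ z) :+ con 8 :* (y :+ w) := (x :+ con 8 :* y) :+ (z :+ con 8 :* w))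
    refl (ψ u a) (ψ u b) (ψ v a) (ψ v b)

weight-~ : ∀ u v → u ~ v → weight u ≡ weight v
weight-~ u v e = cong₂ (λ m n → m + 8 * n) (e a) (e b)

+-%13 : ∀ m n → m % 13 ≡ 0 → (m + n) % 13 ≡ n % 13
+-%13 m n e = trans (%-distribˡ-+ m n 13) (trans (cong (λ k → (k + n % 13) % 13) e) (m%n%n≡m%n n 13))

abab : Word
abab = a ∷ b ∷ a ∷ b ∷ []

-- A prefix x of h(u) of weight r modulo 13 satisfies x · abab ~ h(U) · offset r
-- for some prefix U of u.  Weights 4 and 8 occur both in h(a) and in h(b); there
-- it is the remaining suffix, of content ab and abab respectively, that is
-- common, and U includes the letter that is cut.  The factor abab keeps the
-- other side free of subtraction.  No prefix has weight 2, so offset 2 is junk.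
offset : ℕ → Word
offset 0  = abab
offset 1  = a ∷ a ∷ b ∷ a ∷ b ∷ []
offset 3  = a ∷ b ∷ a ∷ a ∷ b ∷ a ∷ a ∷ b ∷ a ∷ b ∷ a ∷ b ∷ []
offset 4  = a ∷ b ∷ []
offset 5  = b ∷ a ∷ b ∷ a ∷ a ∷ b ∷ a ∷ b ∷ []
offset 6  = a ∷ b ∷ a ∷ a ∷ b ∷ a ∷ b ∷ a ∷ b ∷ []
offset 7  = a ∷ b ∷ a ∷ a ∷ b ∷ a ∷ a ∷ b ∷ a ∷ b ∷ []
offset 8  = []
offset 9  = a ∷ b ∷ a ∷ b ∷ a ∷ b ∷ []
offset 10 = a ∷ b ∷ a ∷ a ∷ b ∷ a ∷ b ∷ []
offset 11 = a ∷ b ∷ a ∷ a ∷ a ∷ b ∷ a ∷ b ∷ []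
offset 12 = a ∷ b ∷ a ∷ a ∷ b ∷ a ∷ a ∷ b ∷ a ∷ b ∷ a ∷ b ∷ a ∷ b ∷ []
offset _  = []

record Anchored (x u : Word) : Set where
  constructor _,_
  field
    weight≢2 : weight x % 13 ≢ 2
    aligned  : x ++ abab ~ h u ++ offset (weight x % 13)

open Anchored

anchored? : ∀ x u → Dec (Anchored x u)
anchored? x u = map′ (λ { (p , q) → p , q }) (λ { (p , q) → p , q })
  (¬? (weight x % 13 ℕ.≟ 2) ×-dec (x ++ abab ~? h u ++ offset (weight x % 13)))

AnchoredAt : Letter → Word → Set
AnchoredAt c x = Anchored x [] ⊎ Anchored x [ c ]

anchoredAt? : ∀ c x → Dec (AnchoredAt c x)
anchoredAt? c x = anchored? x [] ⊎-dec anchored? x [ c ]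

-- A single image has finitely many prefixes, so computation decides; the anchor is the boundary
-- before or after `c`.
anchored-image-inits : ∀ c → All (AnchoredAt c) (inits (image c))
anchored-image-inits a = from-yes (all? (anchoredAt? a) (inits (image a)))
anchored-image-inits b = from-yes (all? (anchoredAt? b) (inits (image b)))

-- The weights are 7 + 8 · 4 = 39 and 2 + 8 · 3 = 26, both multiples of 13.
weight-image : ∀ c → weight (image c) % 13 ≡ 0
weight-image a = refl
weight-image b = refl

weight-image-++ : ∀ c x → weight (image c ++ x) % 13 ≡ weight x % 13
weight-image-++ c x = trans (cong (_% 13) (weight-++ (image c) x))
  (+-%13 (weight (image c)) (weight x) (weight-image c))

-- A whole image in front has weight 0 modulo 13, so the offset does not change and both sides gain
-- `image c`.
anchored-∷ : ∀ c {x u} → Anchored x u → Anchored (image c ++ x) (c ∷ u)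
anchored-∷ c {x} {u} p .weight≢2 e = weight≢2 p (trans (sym (weight-image-++ c x)) e)
anchored-∷ c {x} {u} p .aligned d rewrite weight-image-++ c x = begin
  ψ ((image c ++ x) ++ abab) d               ≡⟨ cong (λ w → ψ w d) (++-assoc (image c) x abab) ⟩
  ψ (image c ++ x ++ abab) d                 ≡⟨ ψ-++ (image c) _ d ⟩
  ψ (image c) d + ψ (x ++ abab) d            ≡⟨ cong (ψ (image c) d +_) (aligned p d) ⟩
  ψ (image c) d + ψ (h u ++ off) d           ≡⟨ ψ-++ (image c) _ d ⟨
  ψ (image c ++ h u ++ off) d                ≡⟨ cong (λ w → ψ w d) (++-assoc (image c) (h u) off) ⟨
  ψ (h (c ∷ u) ++ off) d                     ∎
  where
  open ≡-Reasoning
  off  = offset (weight x % 13)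

-- Induction on `u`: either `x` ends inside the first image, which is the finite check, or that
-- image is stripped from `x` and restored by `anchored-∷`.
anchor : ∀ u x {y} → h u ≡ x ++ y → ∃[ U ] ∃[ U′ ] u ≡ U ++ U′ × Anchored x U
anchor []      []      eq = [] , [] , refl , ((λ ()) , λ { a → refl ; b → refl })
anchor (c ∷ u) x eq with ++-split (image c) x eq
... | inj₁ (r , eq′) with All-inits {AnchoredAt c} x (subst (All (AnchoredAt c) ∘ inits) eq′ (anchored-image-inits c))
...   | inj₁ p = [] , c ∷ u , refl , p
...   | inj₂ p = [ c ] , u , refl , p
anchor (c ∷ u) x eq | inj₂ (r , refl , eq′) with anchor u r eq′
... | U , U′ , refl , p = c ∷ U , U′ , refl , anchored-∷ c p

-- The weights of the cuts as an arithmetic progression.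

abstract
  -- Multiplication by a nonzero `d` permutes the residues modulo the prime 13; here all pairs `r`,
  -- `d` are simply checked.
  hits-2 : ∀ {r} → r < 13 → ∀ {d} → d < 13 → d ≢ 0 → ∃[ j ] j < 13 × (r + j * d) % 13 ≡ 2
  hits-2 = from-yes (ℕ.allUpTo? (λ r → ℕ.allUpTo? (λ d →
    ¬? (d ℕ.≟ 0) →-dec ℕ.anyUpTo? (λ j → (r + j * d) % 13 ℕ.≟ 2) 13) 13) 13)

progression-hits-2 : ∀ s d → d % 13 ≢ 0 → ∃[ j ] j ≤ 12 × (s + j * d) % 13 ≡ 2
progression-hits-2 s d d≢0 with hits-2 (m%n<n s 13) (m%n<n d 13) d≢0
... | j , j<13 , eq = j , s≤s⁻¹ j<13 , (begin
  (s + j * d) % 13                          ≡⟨ %-distribˡ-+ s (j * d) 13 ⟩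
  (s % 13 + (j * d) % 13) % 13              ≡⟨ cong (λ n → (s % 13 + n) % 13) (multiple j) ⟩
  (s % 13 + (j * (d % 13)) % 13) % 13       ≡⟨ cong (λ n → (n + (j * (d % 13)) % 13) % 13) (m%n%n≡m%n s 13) ⟨
  (s % 13 % 13 + (j * (d % 13)) % 13) % 13  ≡⟨ %-distribˡ-+ (s % 13) (j * (d % 13)) 13 ⟨
  (s % 13 + j * (d % 13)) % 13              ≡⟨ eq ⟩
  2                                         ∎)
  where
  open ≡-Reasoning
  multiple : ∀ k → (k * d) % 13 ≡ (k * (d % 13)) % 13
  multiple k = begin
    (k * d) % 13                         ≡⟨ %-distribˡ-* k d 13 ⟩
    (k % 13 * (d % 13)) % 13             ≡⟨ cong (λ n → (k % 13 * n) % 13) (m%n%n≡m%n d 13) ⟨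
    (k % 13 * (d % 13 % 13)) % 13        ≡⟨ %-distribˡ-* k (d % 13) 13 ⟨
    (k * (d % 13)) % 13                  ∎

-- The prefix `p` is `x` followed by the first `j` blocks; the induction absorbs one block at a time
-- into `x`.
cut : ∀ {k} (v : Fin k → Word) {d} x y → (∀ i → weight (v i) ≡ d) → ∀ j → j ≤ k →
      ∃[ p ] ∃[ q ] x ++ concat (tabulate v) ++ y ≡ p ++ q × weight p ≡ weight x + j * d
cut v x y e zero    _ = x , _ , refl , sym (+-identityʳ _)
cut {suc k} v {d} x y e (suc j) (s≤s j≤k) with cut (v ∘ suc) (x ++ v zero) y (e ∘ suc) j j≤k
... | p , q , eq , wt = p , q , eq′ , (begin
  weight p                                 ≡⟨ wt ⟩
  weight (x ++ v zero) + j * d             ≡⟨ cong (_+ j * d) (weight-++ x (v zero)) ⟩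
  weight x + weight (v zero) + j * d       ≡⟨ cong (λ n → weight x + n + j * d) (e zero) ⟩
  weight x + d + j * d                     ≡⟨ +-assoc (weight x) d (j * d) ⟩
  weight x + suc j * d                     ∎)
  where
  open ≡-Reasoning
  rest = concat (tabulate (v ∘ suc))
  eq′ : x ++ (v zero ++ rest) ++ y ≡ p ++ q
  eq′ = begin
    x ++ (v zero ++ rest) ++ y  ≡⟨ cong (x ++_) (++-assoc (v zero) rest y) ⟩
    x ++ v zero ++ rest ++ y    ≡⟨ ++-assoc x (v zero) (rest ++ y) ⟨
    (x ++ v zero) ++ rest ++ y  ≡⟨ eq ⟩
    p ++ q                      ∎

power-weight≡0 : ∀ {u d} (v : Fin 16 → Word) x y → h u ≡ x ++ concat (tabulate v) ++ y →
                 (∀ i → weight (v i) ≡ d) → d % 13 ≡ 0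
power-weight≡0 {u} {d} v x y eq e with d % 13 ℕ.≟ 0
... | yes d≡0 = d≡0
... | no  d≢0 with progression-hits-2 (weight x) d d≢0
-- A sixteenth power has cuts 0 to 16, so cut `j` exists; as a prefix of `h u` it cannot have weight
-- 2 modulo 13.
...   | j , j≤12 , hit with cut v x y e j (≤-trans j≤12 (m≤m+n 12 4))
...     | p , q , eq′ , wt with anchor u p (trans eq eq′)
...       | _ , _ , _ , A = contradiction (trans (cong (_% 13) wt) hit) (weight≢2 A)

-- Pulling a power back through the morphism.

-- Both cuts have the same weight modulo 13, hence the same offset, which cancels. The conclusion is
-- additive because `U` is not yet known to be a prefix of `V`.
anchored-step : ∀ {x v U V} → Anchored x U → Anchored (x ++ v) V → weight v % 13 ≡ 0 →
                ∀ c → ψ (h V) c ≡ ψ (h U) c + ψ v c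
anchored-step {x} {v} {U} {V} p q v≡0 c = +-cancelʳ-≡ (ψ off c) _ _ (begin
  ψ (h V) c + ψ off c              ≡⟨ ψ-++ (h V) off c ⟨
  ψ (h V ++ off) c                 ≡⟨ cong (λ n → ψ (h V ++ offset n) c) same ⟨
  ψ (h V ++ offset (weight (x ++ v) % 13)) c  ≡⟨ aligned q c ⟨
  ψ ((x ++ v) ++ abab) c           ≡⟨ trans (ψ-++ (x ++ v) abab c) (cong (_+ ψ abab c) (ψ-++ x v c)) ⟩
  ψ x c + ψ v c + ψ abab c         ≡⟨ swap (ψ x c) (ψ v c) (ψ abab c) ⟩
  ψ x c + ψ abab c + ψ v c         ≡⟨ cong (_+ ψ v c) (trans (sym (ψ-++ x abab c)) (aligned p c)) ⟩
  ψ (h U ++ off) c + ψ v c         ≡⟨ cong (_+ ψ v c) (ψ-++ (h U) off c) ⟩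
  ψ (h U) c + ψ off c + ψ v c      ≡⟨ swap (ψ (h U) c) (ψ off c) (ψ v c) ⟩
  ψ (h U) c + ψ v c + ψ off c      ∎)
  where
  open ≡-Reasoning
  off  = offset (weight x % 13)
  swap : ∀ k m n → k + m + n ≡ k + n + m
  swap = solve 3 (λ k m n → k :+ m :+ n := k :+ n :+ m) refl
  same : weight (x ++ v) % 13 ≡ weight x % 13
  same = trans (cong (_% 13) (trans (weight-++ x v) (+-comm (weight x) (weight v))))
               (+-%13 (weight v) (weight x) v≡0)

h-[] : ∀ u → h u ~ [] → u ≡ []
h-[] u e = ψ≗0⇒[] u (h-reflects-~ u [] e)

step-forward : ∀ U {U′} V {V′} v → U ++ U′ ≡ V ++ V′ → (∀ c → ψ (h V) c ≡ ψ (h U) c + ψ v c) →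
               ∃[ w ] V ≡ U ++ w × U′ ≡ w ++ V′ × h w ~ v
step-forward U V v eq e with ++-split U V eq
... | inj₂ (w , refl , eq′) = w , refl , eq′ , λ c →
  +-cancelˡ-≡ (ψ (h U) c) _ _ (trans (sym (ψ-h-++ U w c)) (e c))
-- Here `U` is `V ++ r`. The hypothesis makes the contents of `h r` and `v` sum to zero, so `r` is
-- empty and the two anchors coincide.
... | inj₁ (r , refl) with h-[] r r≡0
  where
  sum≡0 : ∀ c → ψ (h r) c + ψ v c ≡ 0
  sum≡0 c = +-cancelˡ-≡ (ψ (h V) c) _ _ (begin
    ψ (h V) c + (ψ (h r) c + ψ v c)  ≡⟨ +-assoc (ψ (h V) c) _ _ ⟨
    ψ (h V) c + ψ (h r) c + ψ v c    ≡⟨ cong (_+ ψ v c) (ψ-h-++ V r c) ⟨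
    ψ (h (V ++ r)) c + ψ v c         ≡⟨ e c ⟨
    ψ (h V) c                        ≡⟨ +-identityʳ _ ⟨
    ψ (h V) c + 0                    ∎)
    where open ≡-Reasoning
  r≡0 : h r ~ []
  r≡0 c = m+n≡0⇒m≡0 (ψ (h r) c) (sum≡0 c)
... | refl rewrite ++-identityʳ V = [] , sym (++-identityʳ V) , ++-cancelˡ V _ _ eq , λ c →
  +-cancelˡ-≡ (ψ (h V) c) _ _ (trans (+-identityʳ _) (e c))

-- Moves from cut to cut, keeping the current one anchored; `w i` is the factor of `u` between
-- consecutive anchors.
pull-back : ∀ {k} (v : Fin k → Word) {u} x y U U′ → u ≡ U ++ U′ → h u ≡ x ++ concat (tabulate v) ++ y →
            Anchored x U → (∀ i → weight (v i) % 13 ≡ 0) →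
            ∃[ w ] ∃[ y′ ] U′ ≡ concat (tabulate {n = k} w) ++ y′ × (∀ i → h (w i) ~ v i)
pull-back {zero}  v x y U U′ eu eh A e = (λ ()) , U′ , refl , λ ()
pull-back {suc k} v {u} x y U U′ eu eh A e
  with rest ← concat (tabulate (v ∘ suc)) in rest≡
  with eh′ ← trans eh (trans (cong (x ++_) (++-assoc (v zero) rest y)) (sym (++-assoc x (v zero) (rest ++ y))))
  with anchor u (x ++ v zero) eh′
... | V , V′ , ev , B
  with step-forward U V (v zero) (trans (sym eu) ev) (anchored-step A B (e zero))
... | w , refl , refl , w~v
  with pull-back (v ∘ suc) (x ++ v zero) y (U ++ w) V′ ev
         (trans eh′ (cong (λ r → (x ++ v zero) ++ r ++ y) (sym rest≡))) B (e ∘ suc)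
... | ws , y′ , refl , ws~vs =
  (λ { zero → w ; (suc i) → ws i }) , y′ , sym (++-assoc w (concat (tabulate ws)) y′) ,
  λ { zero → w~v ; (suc i) → ws~vs i }

h-abelianPowerFree : AbelianPowerFreeMorphism 16 h
h-abelianPowerFree u free x v y eq v~v i with anchor u x eq
... | U , U′ , eu , A
  with pull-back v x y U U′ eu eq A
         -- All blocks have equal weight, so that of `v j` serves as the common difference `d`.
         (λ j → power-weight≡0 {u} v x y eq (λ k → weight-~ (v k) (v j) (v~v k j)))
... | w , y′ , refl , hw~v = ψ≗0⇒[] (v i) λ c →
  trans (sym (hw~v i c)) (cong (λ z → ψ (h z) c)
    (free U w y′ eu (λ j k → h-reflects-~ (w j) (w k) λ d →
      trans (hw~v j d) (trans (v~v j k d) (sym (hw~v k d)))) i))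

-- The fixed point as the limit of the iterates on `a`.

prefixes-comparable : ∀ p q {Ω} → Prefixω p Ω → Prefixω q Ω → length p ≤ length q → ∃[ r ] q ≡ p ++ r
prefixes-comparable []      q       _        _        _ = q , refl
prefixes-comparable (c ∷ p) (d ∷ q) (y , ep) (z , eq) (s≤s l)
  with trans (sym (ep 0)) (eq 0) | prefixes-comparable p q (y , ep ∘ suc) (z , eq ∘ suc) l
... | refl | r , refl = r , refl

++ω-assoc : ∀ p {q y} → (p ++ q) ++ω y ≗ p ++ω q ++ω y
++ω-assoc []      n       = refl
++ω-assoc (c ∷ p) zero    = refl
++ω-assoc (c ∷ p) (suc n) = ++ω-assoc p n

prefix-++ : ∀ p {q Ω} → Prefixω (p ++ q) Ω → Prefixω p Ω
prefix-++ p {q} (y , e) = q ++ω y , λ n → trans (e n) (++ω-assoc p n)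

prefix-applyUpTo : ∀ n Ω → Prefixω (applyUpTo Ω n) Ω
prefix-applyUpTo zero    Ω = Ω , λ _ → refl
prefix-applyUpTo (suc n) Ω with prefix-applyUpTo n (Ω ∘ suc)
... | y , e = y , λ { zero → refl ; (suc i) → e i }

prefix-pointwise : ∀ p {z Ω} → (∀ i → i < length p → Ω i ≡ (p ++ω z) i) → Prefixω p Ω
prefix-pointwise []      {Ω = Ω} e = Ω , λ _ → refl
prefix-pointwise (c ∷ p) {Ω = Ω} e with prefix-pointwise p {Ω = Ω ∘ suc} (λ i l → e (suc i) (s≤s l))
... | y , e′ = y , λ { zero → e 0 (s≤s z≤n) ; (suc i) → e′ i }

++ω-< : ∀ p {y z} i → i < length p → (p ++ω y) i ≡ (p ++ω z) i
++ω-< (c ∷ p) zero    _       = refl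
++ω-< (c ∷ p) (suc i) (s≤s l) = ++ω-< p i l

iterate-h : ℕ → Word
iterate-h zero    = [ a ]
iterate-h (suc n) = h (iterate-h n)

-- `h [ a ]` begins with `a`, and `h` preserves the prefix relation.
iterate-h-suc : ∀ n → ∃[ r ] iterate-h (suc n) ≡ iterate-h n ++ r
iterate-h-suc zero = _ , refl
iterate-h-suc (suc n) with iterate-h-suc n
... | r , eq = h r , trans (cong h eq) (concatMap-++ image (iterate-h n) r)

iterate-h-+ : ∀ k n → ∃[ r ] iterate-h (k + n) ≡ iterate-h n ++ r
iterate-h-+ zero    n = [] , sym (++-identityʳ _)
iterate-h-+ (suc k) n with iterate-h-+ k n | iterate-h-suc (k + n)
... | r , eq | s , eq′ = r ++ s , trans eq′ (trans (cong (_++ s) eq) (++-assoc (iterate-h n) r s))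

length-h : ∀ u → length u ≤ length (h u)
length-h []      = z≤n
length-h (a ∷ u) = s≤s (≤-trans (length-h u) (m≤n+m _ 10))
length-h (b ∷ u) = s≤s (≤-trans (length-h u) (m≤n+m _ 4))

length-h-< : ∀ u → 0 < length u → length u < length (h u)
length-h-< (a ∷ u) _ = s≤s (s≤s (≤-trans (length-h u) (m≤n+m _ 9)))
length-h-< (b ∷ u) _ = s≤s (s≤s (≤-trans (length-h u) (m≤n+m _ 3)))

length-iterate-h : ∀ n → n < length (iterate-h n)
length-iterate-h zero    = s≤s z≤n
length-iterate-h (suc n) = ≤-trans (s≤s (length-iterate-h n))
  (length-h-< (iterate-h n) (≤-trans (s≤s z≤n) (length-iterate-h n)))

-- The tail of a's is junk: position n lies within the n-th iterate.
Ω₃ : InfiniteWord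
Ω₃ n = (iterate-h n ++ω λ _ → a) n

-- Letter `i` of `Ω₃` is read off `iterate-h i`. This word and `iterate-h n` are both prefixes of
-- the iterate of index `n + i`, so they agree at `i`.
iterate-h-prefix : ∀ n → Prefixω (iterate-h n) Ω₃
iterate-h-prefix n = prefix-pointwise (iterate-h n) {λ _ → a} agree
  where
  open ≡-Reasoning
  agree : ∀ i → i < length (iterate-h n) → Ω₃ i ≡ (iterate-h n ++ω λ _ → a) i
  agree i l with iterate-h-+ n i | iterate-h-+ i n
  ... | r , eq | s , eq′ = begin
    (iterate-h i ++ω λ _ → a) i          ≡⟨ ++ω-< (iterate-h i) i (length-iterate-h i) ⟩
    (iterate-h i ++ω r ++ω λ _ → a) i    ≡⟨ ++ω-assoc (iterate-h i) i ⟨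
    ((iterate-h i ++ r) ++ω λ _ → a) i   ≡⟨ cong (λ p → (p ++ω λ _ → a) i) same ⟩
    ((iterate-h n ++ s) ++ω λ _ → a) i   ≡⟨ ++ω-assoc (iterate-h n) i ⟩
    (iterate-h n ++ω s ++ω λ _ → a) i    ≡⟨ ++ω-< (iterate-h n) i l ⟩
    (iterate-h n ++ω λ _ → a) i          ∎
    where
    same : iterate-h i ++ r ≡ iterate-h n ++ s
    same = trans (sym eq) (trans (cong iterate-h (+-comm n i)) eq′)

-- Transfers questions about `Ω₃` to finite words: this iterate is longer than `p`, and prefixes of
-- one infinite word are comparable.
prefix⇒iterate-h : ∀ p → Prefixω p Ω₃ → ∃[ r ] iterate-h (length p) ≡ p ++ r
prefix⇒iterate-h p pre = prefixes-comparable p (iterate-h (length p)) pre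
  (iterate-h-prefix (length p)) (ℕ.<⇒≤ (length-iterate-h (length p)))

concat-applyUpTo : ∀ n (Ω : InfiniteWord) → concat (applyUpTo (λ i → h [ Ω i ]) n) ≡ h (applyUpTo Ω n)
concat-applyUpTo zero    Ω = refl
concat-applyUpTo (suc n) Ω = cong₂ _++_ (++-identityʳ (image (Ω 0))) (concat-applyUpTo n (Ω ∘ suc))

Ω₃-fixedPoint : FixedPoint h Ω₃
Ω₃-fixedPoint = prefix , λ m → m , long m
  where
  prefix : ∀ n → Prefixω (concat (applyUpTo (λ i → h [ Ω₃ i ]) n)) Ω₃
  prefix n rewrite concat-applyUpTo n Ω₃ with prefix⇒iterate-h (applyUpTo Ω₃ n) (prefix-applyUpTo n Ω₃)
  -- A prefix of `Ω₃` lies in some iterate, so its image is a prefix of the next iterate.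
  ... | r , eq = prefix-++ (h (applyUpTo Ω₃ n)) {h r}
    (subst (λ w → Prefixω w Ω₃) (trans (cong h eq) (concatMap-++ image (applyUpTo Ω₃ n) r))
      (iterate-h-prefix (suc (length (applyUpTo Ω₃ n)))))
  long : ∀ m → m ≤ length (concat (applyUpTo (λ i → h [ Ω₃ i ]) m))
  long m rewrite concat-applyUpTo m Ω₃ =
    ≤-trans (≤-reflexive (sym (length-applyUpTo Ω₃ m))) (length-h (applyUpTo Ω₃ m))

-- Avoidance of aaa and bb by a finite automaton.

-- The state is the longest of b, a, aa that ends the word read so far; the empty
-- word is treated like b.
data State : Set where
  ‵b ‵a ‵aa : State

NoAAA-BB : State → Word → Set
NoAAA-BB s   []      = ⊤
NoAAA-BB ‵b  (a ∷ u) = NoAAA-BB ‵a u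
NoAAA-BB ‵a  (a ∷ u) = NoAAA-BB ‵aa u
NoAAA-BB ‵aa (a ∷ u) = ⊥
NoAAA-BB ‵b  (b ∷ u) = ⊥
NoAAA-BB ‵a  (b ∷ u) = NoAAA-BB ‵b u
NoAAA-BB ‵aa (b ∷ u) = NoAAA-BB ‵b u

-- h(c) ends in ba if c is a, and in ab if c is b.
h-state : State → State
h-state ‵b  = ‵b
h-state ‵a  = ‵a
h-state ‵aa = ‵a

-- Each clause runs the automaton through one image by computation: from `h-state s` it reaches
-- `h-state` of the state that `c` leads to from `s`.
h-noAAA-BB : ∀ s u → NoAAA-BB s u → NoAAA-BB (h-state s) (h u)
h-noAAA-BB s   []      p = tt
h-noAAA-BB ‵b  (a ∷ u) p = h-noAAA-BB ‵a u p
h-noAAA-BB ‵a  (a ∷ u) p = h-noAAA-BB ‵aa u p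
h-noAAA-BB ‵a  (b ∷ u) p = h-noAAA-BB ‵b u p
h-noAAA-BB ‵aa (b ∷ u) p = h-noAAA-BB ‵b u p

iterate-h-noAAA-BB : ∀ n → NoAAA-BB ‵b (iterate-h n)
iterate-h-noAAA-BB zero    = tt
iterate-h-noAAA-BB (suc n) = h-noAAA-BB ‵b (iterate-h n) (iterate-h-noAAA-BB n)

noAAA-BB-++ : ∀ s x {u} → NoAAA-BB s (x ++ u) → ∃[ t ] NoAAA-BB t u
noAAA-BB-++ s   []      p = s , p
noAAA-BB-++ ‵b  (a ∷ x) p = noAAA-BB-++ ‵a x p
noAAA-BB-++ ‵a  (a ∷ x) p = noAAA-BB-++ ‵aa x p
noAAA-BB-++ ‵a  (b ∷ x) p = noAAA-BB-++ ‵b x p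
noAAA-BB-++ ‵aa (b ∷ x) p = noAAA-BB-++ ‵b x p

factor⇒iterate-h : ∀ x u {y} → Ω₃ ≗ x ++ω u ++ω y → ∃[ n ] ∃[ r ] iterate-h n ≡ x ++ u ++ r
factor⇒iterate-h x u {y} e with prefix⇒iterate-h (x ++ u) (y , λ n → trans (e n) (sym (++ω-assoc x n)))
... | r , eq = length (x ++ u) , r , trans eq (++-assoc x u r)

factor⇒noAAA-BB : ∀ u → Factorω u Ω₃ → ∃[ s ] ∃[ r ] NoAAA-BB s (u ++ r)
factor⇒noAAA-BB u (x , y , e) with factor⇒iterate-h x u e
... | n , r , eq with noAAA-BB-++ ‵b x (subst (NoAAA-BB ‵b) eq (iterate-h-noAAA-BB n))
... | s , p = s , r , p

no-aaa : ¬ Factorω (a ∷ a ∷ a ∷ []) Ω₃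
no-aaa f with factor⇒noAAA-BB (a ∷ a ∷ a ∷ []) f
... | ‵b  , _ , ()
... | ‵a  , _ , ()
... | ‵aa , _ , ()

no-bb : ¬ Factorω (b ∷ b ∷ []) Ω₃
no-bb f with factor⇒noAAA-BB (b ∷ b ∷ []) f
... | ‵b  , _ , ()
... | ‵a  , _ , ()
... | ‵aa , _ , ()

-- Abelian power freeness of the fixed point.

-- Two blocks of equal content count every letter twice, but no letter occurs twice in `[ a ]`.
[a]-abelianPowerFree : ∀ k → AbelianPowerFree (2 + k) [ a ]
[a]-abelianPowerFree k x v y eq v~v i = ψ≗0⇒[] (v i) λ c → trans (v~v i zero c) (twice≤1 (twice c))
  where
  v₀ = v zero
  v₁ = v (suc zero)
  rest = concat (tabulate (λ j → v (suc (suc j))))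
  twice : ∀ c → ψ v₀ c + ψ v₀ c ≤ 1
  twice c = begin
    ψ v₀ c + ψ v₀ c                ≡⟨ cong (ψ v₀ c +_) (v~v zero (suc zero) c) ⟩
    ψ v₀ c + ψ v₁ c                ≤⟨ +-monoʳ-≤ (ψ v₀ c) (ψ-++-≤ˡ v₁ rest) ⟩
    ψ v₀ c + ψ (v₁ ++ rest) c      ≡⟨ ψ-++ v₀ (v₁ ++ rest) c ⟨
    ψ (v₀ ++ v₁ ++ rest) c         ≤⟨ ψ-++-≤ˡ (v₀ ++ v₁ ++ rest) y ⟩
    ψ ((v₀ ++ v₁ ++ rest) ++ y) c  ≤⟨ m≤n+m _ (ψ x c) ⟩
    ψ x c + ψ ((v₀ ++ v₁ ++ rest) ++ y) c  ≡⟨ ψ-++ x _ c ⟨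
    ψ (x ++ (v₀ ++ v₁ ++ rest) ++ y) c     ≡⟨ cong (λ w → ψ w c) eq ⟨
    ψ [ a ] c                      ≤⟨ single c ⟩
    1                              ∎
    where
    open ℕ.≤-Reasoning
    ψ-++-≤ˡ : ∀ p q → ψ p c ≤ ψ (p ++ q) c
    ψ-++-≤ˡ p q = ≤-trans (m≤m+n (ψ p c) (ψ q c)) (≤-reflexive (sym (ψ-++ p q c)))
    single : ∀ c → ψ [ a ] c ≤ 1
    single a = ≤-refl
    single b = z≤n
  twice≤1 : ∀ {n} → n + n ≤ 1 → n ≡ 0
  twice≤1 {zero}  _ = refl
  twice≤1 {suc n} (s≤s l) with () ← m+n≡0⇒n≡0 n (n≤0⇒n≡0 l)

iterate-h-abelianPowerFree : ∀ n → AbelianPowerFree 16 (iterate-h n)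
iterate-h-abelianPowerFree zero    = [a]-abelianPowerFree 14
iterate-h-abelianPowerFree (suc n) = h-abelianPowerFree (iterate-h n) (iterate-h-abelianPowerFree n)

Ω₃-abelianPowerFree : AbelianPowerFreeω 16 Ω₃
Ω₃-abelianPowerFree x v y e v~v with factor⇒iterate-h x (concat (tabulate v)) e
... | n , r , eq = iterate-h-abelianPowerFree n x v r eq v~v

theorem2p17 : ∃[ h ] ∃[ Ω₃ ]
    ( IsMorphism h
    × AbelianPowerFreeMorphism 16 h
    × FixedPoint h Ω₃
    × ¬ Factorω (a ∷ a ∷ a ∷ []) Ω₃
    × ¬ Factorω (b ∷ b ∷ []) Ω₃
    × AbelianPowerFreeω 16 Ω₃ )
theorem2p17 =
  h , Ω₃ , h-isMorphism , h-abelianPowerFree , Ω₃-fixedPoint , no-aaa , no-bb , Ω₃-abelianPowerFree
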